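{- Let $N\ge 1$ be an integer, and let $\psi:\mathbb{Q}[x_0,\ldots,x_N]\to\mathbb{Q}[x_0,\ldots,x_N]$ be a $(\mathcal{D},\mathcal{D}_{\mathcal{K}_2})$-intertwining map, and suppose that it has the form $$\psi(x_0)=x_0,\qquad \psi(x_n)=\sum_{i=1}^n B(n,i)\,x_i\quad(1\le n\le N).$$ Then $$B(n,k)=k!\,S(n,k),$$ where $S(n,k)$ are the Stirling numbers of the second kind.
   Context: A derivation of $\mathbb{Q}[x_0,\ldots,x_N]$ is a $\mathbb{Q}$-linear map satisfying the Leibniz rule; it is determined by its values on the variables. The basic Weitzenböck derivation is $\mathcal{D}=x_0\frac{\partial}{\partial x_1}+2x_1\frac{\partial}{\partial x_2}+\cdots+N x_{N-1}\frac{\partial}{\partial x_N}$, i.e. $\mathcal{D}(x_0)=0$ and $\mathcal{D}(x_n)=n\,x_{n-1}$ for $1\le n\le N$. The second Kravchuk derivation $\mathcal{D}_{\mathcal{K}_2}$ is the derivation with $$\mathcal{D}_{\mathcal{K}_2}(x_0)=0,\qquad \mathcal{D}_{\mathcal{K}_2}(x_n)=\sum_{i=0}^{n-1}\frac{(-1)^{n+1+i}}{n-i}\,x_i\quad(1\le n\le N).$$ A $(\mathcal{D},\mathcal{D}_{\mathcal{K}_2})$-intertwining map is a multiplicative linear map $\psi$ with $\psi\,\mathcal{D}=\mathcal{D}_{\mathcal{K}_2}\psi$. The coefficients $B(n,k)$ are those with $1\le k\le n\le N$. -}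

module Defs where

open import Level using (0ℓ)
open import Data.Nat.Base as ℕ using (ℕ; zero; suc)
import Data.Nat.Properties as ℕₚ
open import Data.Integer.Base as ℤ using (+_; -1ℤ)
open import Data.Fin.Base using (Fin; zero; suc; toℕ; inject; inject₁)
import Data.Fin.Properties as Finₚ
open import Data.Product.Base using (_,_)
open import Data.Rational.Base as ℚ using (ℚ; 0ℚ; 1ℚ; _/_)
import Data.Rational.Properties as ℚₚ
open import Algebra.Bundles using (CommutativeRing)
open import Algebra.Module.Bundles using (LeftModule)
open import Algebra.Module.Morphism.Structures using (module LeftModuleMorphisms)
import Algebra.Morphism.Definitions as MorphismDefinitions
import Algebra.Properties.CommutativeMonoid.Sum as Sum
open import Relation.Binary.PropositionalEquality using (_≡_; cong)
import Relation.Binary.PropositionalEquality as ≡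
import Relation.Binary.Reasoning.Setoid as SetoidReasoning

infixl 6 _⊕_
infixl 7 _⊗_
infixr 7 _·_
infix  4 _≈_

-- ℚ[x₀, …, x_{m-1}] as the free commutative ℚ-algebra on Fin m: terms,
-- with equality the congruence generated by the commutative ring laws
-- and by con : ℚ → Poly m being a ring homomorphism.

data Poly (m : ℕ) : Set where
  con : ℚ → Poly m
  var : Fin m → Poly m
  _⊕_ : Poly m → Poly m → Poly m
  _⊗_ : Poly m → Poly m → Poly m

_·_ : ∀ {m} → ℚ → Poly m → Poly m
c · p = con c ⊗ p

⊖_ : ∀ {m} → Poly m → Poly m
⊖ p = (ℚ.- 1ℚ) · p

data _≈_ {m : ℕ} : Poly m → Poly m → Set where
  ≈-refl      : ∀ {p} → p ≈ p
  ≈-sym       : ∀ {p q} → p ≈ q → q ≈ p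
  ≈-trans     : ∀ {p q r} → p ≈ q → q ≈ r → p ≈ r
  ⊕-cong      : ∀ {p p′ q q′} → p ≈ p′ → q ≈ q′ → p ⊕ q ≈ p′ ⊕ q′
  ⊗-cong      : ∀ {p p′ q q′} → p ≈ p′ → q ≈ q′ → p ⊗ q ≈ p′ ⊗ q′
  ⊕-assoc     : ∀ p q r → (p ⊕ q) ⊕ r ≈ p ⊕ (q ⊕ r)
  ⊕-comm      : ∀ p q → p ⊕ q ≈ q ⊕ p
  ⊕-identityˡ : ∀ p → con 0ℚ ⊕ p ≈ p
  ⊗-assoc     : ∀ p q r → (p ⊗ q) ⊗ r ≈ p ⊗ (q ⊗ r)
  ⊗-comm      : ∀ p q → p ⊗ q ≈ q ⊗ p
  ⊗-identityˡ : ∀ p → con 1ℚ ⊗ p ≈ p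
  ⊗-zeroˡ     : ∀ p → con 0ℚ ⊗ p ≈ con 0ℚ
  ⊗-distribˡ  : ∀ p q r → p ⊗ (q ⊕ r) ≈ (p ⊗ q) ⊕ (p ⊗ r)
  con-⊕       : ∀ a b → con (a ℚ.+ b) ≈ con a ⊕ con b
  con-⊗       : ∀ a b → con (a ℚ.* b) ≈ con a ⊗ con b

≈-reflexive : ∀ {m} {p q : Poly m} → p ≡ q → p ≈ q
≈-reflexive ≡.refl = ≈-refl

module _ {m : ℕ} where

  ⊕-identityʳ : (p : Poly m) → p ⊕ con 0ℚ ≈ p
  ⊕-identityʳ p = ≈-trans (⊕-comm p (con 0ℚ)) (⊕-identityˡ p)

  ⊗-identityʳ : (p : Poly m) → p ⊗ con 1ℚ ≈ p
  ⊗-identityʳ p = ≈-trans (⊗-comm p (con 1ℚ)) (⊗-identityˡ p)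

  ⊗-zeroʳ : (p : Poly m) → p ⊗ con 0ℚ ≈ con 0ℚ
  ⊗-zeroʳ p = ≈-trans (⊗-comm p (con 0ℚ)) (⊗-zeroˡ p)

  ⊗-distribʳ : (r p q : Poly m) → (p ⊕ q) ⊗ r ≈ (p ⊗ r) ⊕ (q ⊗ r)
  ⊗-distribʳ r p q = ≈-trans (⊗-comm (p ⊕ q) r)
    (≈-trans (⊗-distribˡ r p q) (⊕-cong (⊗-comm r p) (⊗-comm r q)))

  ·-distribʳ : (p : Poly m) (a b : ℚ) → (a ℚ.+ b) · p ≈ (a · p) ⊕ (b · p)
  ·-distribʳ p a b = ≈-trans (⊗-cong (con-⊕ a b) ≈-refl)
    (⊗-distribʳ p (con a) (con b))

  ⊖-inverseˡ : (p : Poly m) → ⊖ p ⊕ p ≈ con 0ℚ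
  ⊖-inverseˡ p = ≈-trans (⊕-cong ≈-refl (≈-sym (⊗-identityˡ p)))
    (≈-trans (≈-sym (·-distribʳ p (ℚ.- 1ℚ) 1ℚ)) (⊗-zeroˡ p))

  ⊖-inverseʳ : (p : Poly m) → p ⊕ ⊖ p ≈ con 0ℚ
  ⊖-inverseʳ p = ≈-trans (⊕-comm p (⊖ p)) (⊖-inverseˡ p)

polyRing : ℕ → CommutativeRing 0ℓ 0ℓ
polyRing m = record
  { Carrier = Poly m
  ; _≈_ = _≈_
  ; _+_ = _⊕_
  ; _*_ = _⊗_
  ; -_ = ⊖_
  ; 0# = con 0ℚ
  ; 1# = con 1ℚ
  ; isCommutativeRing = record
    { isRing = record
      { +-isAbelianGroup = record
        { isGroup = record
          { isMonoid = record
            { isSemigroup = record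
              { isMagma = record
                { isEquivalence = record
                  { refl = ≈-refl ; sym = ≈-sym ; trans = ≈-trans }
                ; ∙-cong = ⊕-cong
                }
              ; assoc = ⊕-assoc
              }
            ; identity = ⊕-identityˡ , ⊕-identityʳ
            }
          ; inverse = ⊖-inverseˡ , ⊖-inverseʳ
          ; ⁻¹-cong = ⊗-cong ≈-refl
          }
        ; comm = ⊕-comm
        }
      ; *-cong = ⊗-cong
      ; *-assoc = ⊗-assoc
      ; *-identity = ⊗-identityˡ , ⊗-identityʳ
      ; distrib = ⊗-distribˡ , ⊗-distribʳ
      }
    ; *-comm = ⊗-comm
    }
  }

polyModule : ℕ → LeftModule ℚₚ.+-*-ring 0ℓ 0ℓ
polyModule m = record
  { Carrierᴹ = Poly m
  ; _≈ᴹ_ = _≈_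
  ; _+ᴹ_ = _⊕_
  ; _*ₗ_ = _·_
  ; 0ᴹ = con 0ℚ
  ; -ᴹ_ = ⊖_
  ; isLeftModule = record
    { isLeftSemimodule = record
      { +ᴹ-isCommutativeMonoid = CommutativeRing.+-isCommutativeMonoid (polyRing m)
      ; isPreleftSemimodule = record
        { *ₗ-cong = λ a≡b → ⊗-cong (≈-reflexive (cong con a≡b))
        ; *ₗ-zeroˡ = ⊗-zeroˡ
        ; *ₗ-distribʳ = ·-distribʳ
        ; *ₗ-identityˡ = ⊗-identityˡ
        ; *ₗ-assoc = λ a b p →
            ≈-trans (⊗-cong (con-⊗ a b) ≈-refl) (⊗-assoc (con a) (con b) p)
        ; *ₗ-zeroʳ = λ a → ⊗-zeroʳ (con a)
        ; *ₗ-distribˡ = λ a → ⊗-distribˡ (con a)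
        }
      }
    ; -ᴹ‿cong = ⊗-cong ≈-refl
    ; -ᴹ‿inverse = ⊖-inverseˡ , ⊖-inverseʳ
    }
  }

module _ {m : ℕ} where
  open Sum (CommutativeRing.+-commutativeMonoid (polyRing m)) public
    using (sum-syntax)

IsLinear : ∀ {m} → (Poly m → Poly m) → Set
IsLinear {m} = IsLeftModuleHomomorphism
  where
  V = LeftModule.rawLeftModule (polyModule m)
  open LeftModuleMorphisms V V

IsMultiplicative : ∀ {m} → (Poly m → Poly m) → Set
IsMultiplicative {m} φ = Homomorphic₂ φ _⊗_ _⊗_
  where open MorphismDefinitions (Poly m) (Poly m) _≈_

record IsDerivation {m : ℕ} (D : Poly m → Poly m) : Set where
  field
    isLinear : IsLinear D
    leibniz  : ∀ p q → D (p ⊗ q) ≈ (D p ⊗ q) ⊕ (p ⊗ D q)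

derivation : ∀ {m} → (Fin m → Poly m) → Poly m → Poly m
derivation f (con _) = con 0ℚ
derivation f (var i) = f i
derivation f (p ⊕ q) = derivation f p ⊕ derivation f q
derivation f (p ⊗ q) = (derivation f p ⊗ q) ⊕ (p ⊗ derivation f q)

module _ {m : ℕ} (f : Fin m → Poly m) where

  private
    D = derivation f
    module R = CommutativeRing (polyRing m)

  open SetoidReasoning R.setoid

  D-scale : ∀ c p → D (c · p) ≈ c · D p
  D-scale c p =
    ≈-trans (⊕-cong (⊗-zeroˡ p) ≈-refl) (⊕-identityˡ (con c ⊗ D p))

  D-cong : ∀ {p q} → p ≈ q → D p ≈ D q
  D-cong ≈-refl = ≈-refl
  D-cong (≈-sym e) = ≈-sym (D-cong e)
  D-cong (≈-trans e e′) = ≈-trans (D-cong e) (D-cong e′)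
  D-cong (⊕-cong e e′) = ⊕-cong (D-cong e) (D-cong e′)
  D-cong (⊗-cong e e′) =
    ⊕-cong (⊗-cong (D-cong e) e′) (⊗-cong e (D-cong e′))
  D-cong (⊕-assoc p q r) = ⊕-assoc (D p) (D q) (D r)
  D-cong (⊕-comm p q) = ⊕-comm (D p) (D q)
  D-cong (⊕-identityˡ p) = ⊕-identityˡ (D p)
  D-cong (⊗-assoc p q r) = begin
    (D p ⊗ q ⊕ p ⊗ D q) ⊗ r ⊕ (p ⊗ q) ⊗ D r
      ≈⟨ R.+-congʳ (⊗-distribʳ r (D p ⊗ q) (p ⊗ D q)) ⟩
    ((D p ⊗ q) ⊗ r ⊕ (p ⊗ D q) ⊗ r) ⊕ (p ⊗ q) ⊗ D r
      ≈⟨ ⊕-cong (⊕-cong (⊗-assoc (D p) q r) (⊗-assoc p (D q) r)) (⊗-assoc p q (D r)) ⟩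
    (D p ⊗ (q ⊗ r) ⊕ p ⊗ (D q ⊗ r)) ⊕ p ⊗ (q ⊗ D r)
      ≈⟨ ⊕-assoc _ _ _ ⟩
    D p ⊗ (q ⊗ r) ⊕ (p ⊗ (D q ⊗ r) ⊕ p ⊗ (q ⊗ D r))
      ≈⟨ R.+-congˡ (⊗-distribˡ p (D q ⊗ r) (q ⊗ D r)) ⟨
    D p ⊗ (q ⊗ r) ⊕ p ⊗ (D q ⊗ r ⊕ q ⊗ D r) ∎
  D-cong (⊗-comm p q) = ≈-trans (⊕-cong (⊗-comm (D p) q) (⊗-comm p (D q)))
    (⊕-comm (q ⊗ D p) (D q ⊗ p))
  D-cong (⊗-identityˡ p) = ≈-trans (D-scale 1ℚ p) (⊗-identityˡ (D p))
  D-cong (⊗-zeroˡ p) = ≈-trans (D-scale 0ℚ p) (⊗-zeroˡ (D p))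
  D-cong (⊗-distribˡ p q r) = begin
    D p ⊗ (q ⊕ r) ⊕ p ⊗ (D q ⊕ D r)
      ≈⟨ ⊕-cong (⊗-distribˡ (D p) q r) (⊗-distribˡ p (D q) (D r)) ⟩
    (D p ⊗ q ⊕ D p ⊗ r) ⊕ (p ⊗ D q ⊕ p ⊗ D r)
      ≈⟨ ⊕-assoc _ _ _ ⟩
    D p ⊗ q ⊕ (D p ⊗ r ⊕ (p ⊗ D q ⊕ p ⊗ D r))
      ≈⟨ R.+-congˡ (⊕-assoc _ _ _) ⟨
    D p ⊗ q ⊕ ((D p ⊗ r ⊕ p ⊗ D q) ⊕ p ⊗ D r)
      ≈⟨ R.+-congˡ (R.+-congʳ (⊕-comm _ _)) ⟩
    D p ⊗ q ⊕ ((p ⊗ D q ⊕ D p ⊗ r) ⊕ p ⊗ D r)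
      ≈⟨ R.+-congˡ (⊕-assoc _ _ _) ⟩
    D p ⊗ q ⊕ (p ⊗ D q ⊕ (D p ⊗ r ⊕ p ⊗ D r))
      ≈⟨ ⊕-assoc _ _ _ ⟨
    (D p ⊗ q ⊕ p ⊗ D q) ⊕ (D p ⊗ r ⊕ p ⊗ D r) ∎
  D-cong (con-⊕ a b) = ≈-sym (⊕-identityˡ (con 0ℚ))
  D-cong (con-⊗ a b) = ≈-sym
    (≈-trans (⊕-cong (⊗-zeroˡ (con b)) (⊗-zeroʳ (con a))) (⊕-identityˡ (con 0ℚ)))

  derivation-isDerivation : IsDerivation (derivation f)
  derivation-isDerivation = record
    { isLinear = record
      { +ᴹ-isGroupHomomorphism = record
        { isMonoidHomomorphism = record
          { isMagmaHomomorphism = record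
            { isRelHomomorphism = record { cong = D-cong }
            ; homo = λ _ _ → ≈-refl
            }
          ; ε-homo = ≈-refl
          }
        ; ⁻¹-homo = D-scale (ℚ.- 1ℚ)
        }
      ; *ₗ-homo = D-scale
      }
    ; leibniz = λ _ _ → ≈-refl
    }

fromℕ : ℕ → ℚ
fromℕ n = + n / 1

weitzenböck-value : ∀ {N} → Fin (suc N) → Poly (suc N)
weitzenböck-value zero    = con 0ℚ
weitzenböck-value (suc j) = fromℕ (suc (toℕ j)) · var (inject₁ j)

𝒟 : ∀ N → Poly (suc N) → Poly (suc N)
𝒟 N = derivation weitzenböck-value

kravchuk₂-coeff : (n : ℕ) → Fin n → ℚ
kravchuk₂-coeff n i =
  _/_ (-1ℤ ℤ.^ (n ℕ.+ 1 ℕ.+ toℕ i)) (n ℕ.∸ toℕ i)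
      {{ℕ.>-nonZero (ℕₚ.m<n⇒0<n∸m (Finₚ.toℕ<n i))}}

kravchuk₂-value : ∀ {N} → Fin (suc N) → Poly (suc N)
kravchuk₂-value zero      = con 0ℚ
kravchuk₂-value n@(suc _) =
  ∑[ i < toℕ n ] (kravchuk₂-coeff (toℕ n) i · var (inject {i = n} i))

𝒟𝒦₂ : ∀ N → Poly (suc N) → Poly (suc N)
𝒟𝒦₂ N = derivation kravchuk₂-value

-- Multiplicativity does not include ψ 1 = 1.

record IsIntertwining {m : ℕ} (D E ψ : Poly m → Poly m) : Set where
  field
    isLinear         : IsLinear ψ
    isMultiplicative : IsMultiplicative ψ
    intertwines      : ∀ p → ψ (D p) ≈ E (ψ p)

stirling₂ : ℕ → ℕ → ℕ
stirling₂ zero    zero    = 1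
stirling₂ zero    (suc k) = 0
stirling₂ (suc n) zero    = 0
stirling₂ (suc n) (suc k) = suc k ℕ.* stirling₂ n (suc k) ℕ.+ stirling₂ n k

{-# OPTIONS --safe #-}
-- Identify x_i with y^i.  Then 𝒟𝒦₂ becomes multiplication by log (1 + 1/y) followed
-- by discarding negative powers of y, and the claimed values F_n = Σ_k k! S(n,k) y^k of
-- ψ satisfy F_{n+1} = y d/dy ((1 + y) F_n).  The commutator of the two operators is 1, so
-- induction on n gives 𝒟𝒦₂ F_n = n F_{n-1}.  This is the intertwining relation, and it
-- determines ψ(x_n) from ψ(x_{n-1}) because 𝒟𝒦₂ is triangular with units on the diagonal.

module Submission where

open import Defs
open import Data.Nat.Base using (ℕ; suc; _≤_; _*_; _!)
open import Data.Fin.Base using (Fin; zero; suc; toℕ; inject≤)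
open import Data.Fin.Properties using (toℕ<n)
open import Data.Rational.Base using (ℚ)
open import Relation.Binary.PropositionalEquality using (_≡_)

open import Algebra.Bundles using (CommutativeRing)
open import Algebra.Module.Morphism.Structures using (module LeftModuleMorphisms)
import Algebra.Properties.Group as GroupProperties
import Algebra.Properties.Semiring.Sum as SemiringSum
open import Data.Fin.Base using (inject; inject₁; fromℕ<)
import Data.Fin.Induction as Fin
import Data.Fin.Properties as Fin
open import Data.Integer.Base as ℤ using (+_; -1ℤ)
import Data.Integer.Properties as ℤ
open import Data.Nat.Base as ℕ using (zero; z≤n; s≤s; _<_)
import Data.Nat.Properties as ℕ
import Data.Nat.Tactic.RingSolver as ℕ-Solver
open import Data.Rational.Base as ℚ using (0ℚ; 1ℚ; _/_; fromℚᵘ)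
import Data.Rational.Properties as ℚ
open import Data.Rational.Solver using (module +-*-Solver)
open import Data.Rational.Unnormalised.Base as ℚᵘ using (mkℚᵘ; *≡*)
import Data.Rational.Unnormalised.Properties as ℚᵘ
open import Function.Base using (_∘_)
open import Relation.Binary.PropositionalEquality
  using (refl; sym; trans; cong; cong₂; subst; module ≡-Reasoning)

private module ℚ-+ = GroupProperties ℚ.+-0-group

open ≡-Reasoning
open +-*-Solver using (solve; _:=_; _:+_; _:*_)
open SemiringSum (CommutativeRing.semiring ℚ.+-*-commutativeRing)
  using (sum; sum-cong-≗; ∑-distrib-+; *-distribˡ-sum)

-- Arithmetic of integers and fractions inside the rationals.

fromℚᵘ-homo-+ : ∀ p q → fromℚᵘ (p ℚᵘ.+ q) ≡ fromℚᵘ p ℚ.+ fromℚᵘ q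
fromℚᵘ-homo-+ p q = ℚ.toℚᵘ-injective (ℚᵘ.≃-trans (ℚ.toℚᵘ-fromℚᵘ (p ℚᵘ.+ q))
  (ℚᵘ.≃-sym (ℚᵘ.≃-trans (ℚ.toℚᵘ-homo-+ (fromℚᵘ p) (fromℚᵘ q))
    (ℚᵘ.+-cong (ℚ.toℚᵘ-fromℚᵘ p) (ℚ.toℚᵘ-fromℚᵘ q)))))

fromℚᵘ-homo-* : ∀ p q → fromℚᵘ (p ℚᵘ.* q) ≡ fromℚᵘ p ℚ.* fromℚᵘ q
fromℚᵘ-homo-* p q = ℚ.toℚᵘ-injective (ℚᵘ.≃-trans (ℚ.toℚᵘ-fromℚᵘ (p ℚᵘ.* q))
  (ℚᵘ.≃-sym (ℚᵘ.≃-trans (ℚ.toℚᵘ-homo-* (fromℚᵘ p) (fromℚᵘ q))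
    (ℚᵘ.*-cong (ℚ.toℚᵘ-fromℚᵘ p) (ℚ.toℚᵘ-fromℚᵘ q)))))

/1-homo-+ : ∀ a b → (a ℤ.+ b) / 1 ≡ a / 1 ℚ.+ b / 1
/1-homo-+ a b = trans
  -- Adding two fractions with denominator 1 produces the numerator `a * 1 + b * 1`.
  (cong (_/ 1) (sym (cong₂ ℤ._+_ (ℤ.*-identityʳ a) (ℤ.*-identityʳ b))))
  (fromℚᵘ-homo-+ (mkℚᵘ a 0) (mkℚᵘ b 0))

/1-homo-* : ∀ a b → (a ℤ.* b) / 1 ≡ (a / 1) ℚ.* (b / 1)
/1-homo-* a b = fromℚᵘ-homo-* (mkℚᵘ a 0) (mkℚᵘ b 0)

/-*-cancel : ∀ a n → fromℕ (suc n) ℚ.* (a / suc n) ≡ a / 1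
/-*-cancel a n = trans (sym (fromℚᵘ-homo-* (mkℚᵘ (+ suc n) 0) (mkℚᵘ a n)))
  (ℚ.fromℚᵘ-cong {mkℚᵘ (+ suc n) 0 ℚᵘ.* mkℚᵘ a n} {mkℚᵘ a 0}
    (*≡* (trans (ℤ.*-identityʳ _) (trans (ℤ.*-comm (+ suc n) a)
      (cong (a ℤ.*_) (cong +_ (sym (ℕ.*-identityˡ (suc n)))))))))

fromℕ-+ : ∀ m n → fromℕ (m ℕ.+ n) ≡ fromℕ m ℚ.+ fromℕ n
fromℕ-+ m n = /1-homo-+ (+ m) (+ n)

fromℕ-* : ∀ m n → fromℕ (m * n) ≡ fromℕ m ℚ.* fromℕ n
fromℕ-* m n = trans (cong (_/ 1) (ℤ.pos-* m n)) (/1-homo-* (+ m) (+ n))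

fromℕ-suc : ∀ n → fromℕ (suc n) ≡ 1ℚ ℚ.+ fromℕ n
fromℕ-suc = fromℕ-+ 1

-- Finite sums over initial segments, and the Kronecker delta.

sumTo : ℕ → (ℕ → ℚ) → ℚ
sumTo n f = sum {n} (f ∘ toℕ)

sumTo-cong : ∀ n {f g : ℕ → ℚ} → (∀ i → f i ≡ g i) → sumTo n f ≡ sumTo n g
sumTo-cong n f≗g = sum-cong-≗ {n} (f≗g ∘ toℕ)

sumTo-+ : ∀ n f g → sumTo n (λ i → f i ℚ.+ g i) ≡ sumTo n f ℚ.+ sumTo n g
sumTo-+ n f g = ∑-distrib-+ {n} (f ∘ toℕ) (g ∘ toℕ)

sumTo-*ˡ : ∀ n c f → sumTo n (λ i → c ℚ.* f i) ≡ c ℚ.* sumTo n f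
sumTo-*ˡ n c f = sym (*-distribˡ-sum {n} c (f ∘ toℕ))

sumTo-zero : ∀ n {f : ℕ → ℚ} → (∀ i → f i ≡ 0ℚ) → sumTo n f ≡ 0ℚ
sumTo-zero zero    f≗0 = refl
sumTo-zero (suc n) f≗0 = cong₂ ℚ._+_ (f≗0 0) (sumTo-zero n (f≗0 ∘ suc))

sumTo-last : ∀ n f → sumTo (suc n) f ≡ sumTo n f ℚ.+ f n
sumTo-last zero    f = ℚ.+-comm (f 0) 0ℚ
sumTo-last (suc n) f = trans (cong (f 0 ℚ.+_) (sumTo-last n (f ∘ suc)))
  (sym (ℚ.+-assoc (f 0) _ _))

δ : ℕ → ℕ → ℚ
δ zero    zero    = 1ℚ
δ zero    (suc j) = 0ℚ
δ (suc i) zero    = 0ℚ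
δ (suc i) (suc j) = δ i j

-- If `j` lies outside the range, the sum is empty of nonzero terms; the hypothesis makes `f j`
-- vanish too, so later uses need no bound on `j`.
sumTo-δ : ∀ n (f : ℕ → ℚ) j → (n ≤ j → f j ≡ 0ℚ) → sumTo n (λ i → f i ℚ.* δ i j) ≡ f j
sumTo-δ zero    f j       f≡0 = sym (f≡0 z≤n)
sumTo-δ (suc n) f zero    f≡0 = trans
  (cong₂ ℚ._+_ (ℚ.*-identityʳ (f 0)) (sumTo-zero n (λ i → ℚ.*-zeroʳ (f (suc i)))))
  (ℚ.+-identityʳ (f 0))
sumTo-δ (suc n) f (suc j) f≡0 = trans
  (cong₂ ℚ._+_ (ℚ.*-zeroʳ (f 0)) (sumTo-δ n (f ∘ suc) j (f≡0 ∘ s≤s)))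
  (ℚ.+-identityˡ (f (suc j)))

-- The truncated logarithm series and its commutator.

-- The coefficient of y^j, for j ≥ 0, in y^i log (1 + 1/y).
logCoeff : ℕ → ℕ → ℚ
logCoeff zero    j       = 0ℚ
logCoeff (suc i) zero    = (-1ℤ ℤ.^ i) / suc i
logCoeff (suc i) (suc j) = logCoeff i j

-- The coefficient of y^j, for j ≥ 0, in y^i / (1 + y) expanded in powers of 1/y.
sign : ℕ → ℕ → ℚ
sign zero    j       = 0ℚ
sign (suc i) zero    = (-1ℤ ℤ.^ i) / 1
sign (suc i) (suc j) = sign i j

-- Multiplying y^i / (1 + y) by 1 + y gives back y^i: alternating signs cancel except on the
-- diagonal.
sign-suc : ∀ i j → sign i j ℚ.+ sign (suc i) j ≡ δ i j
sign-suc zero    zero    = refl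
sign-suc zero    (suc j) = refl
sign-suc (suc i) zero    = trans
  (sym (/1-homo-+ (-1ℤ ℤ.^ i) (-1ℤ ℤ.* -1ℤ ℤ.^ i)))
  (cong (_/ 1) (trans (cong (λ z → -1ℤ ℤ.^ i ℤ.+ z) (ℤ.-1*i≡-i (-1ℤ ℤ.^ i)))
    (ℤ.+-inverseʳ (-1ℤ ℤ.^ i))))
sign-suc (suc i) (suc j) = sign-suc i j

-- This is y d/dy log (1 + 1/y) = -1 / (1 + y): the factor i - j cancels the denominator and leaves
-- only the sign.
logCoeff-sign : ∀ i j →
  fromℕ i ℚ.* logCoeff i j ≡ fromℕ j ℚ.* logCoeff i j ℚ.+ sign i j
logCoeff-sign zero    j    = sym (cong (ℚ._+ 0ℚ) (ℚ.*-zeroʳ (fromℕ j)))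
logCoeff-sign (suc i) zero = trans (/-*-cancel (-1ℤ ℤ.^ i) i)
  (sym (trans (cong (ℚ._+ s) (ℚ.*-zeroˡ c)) (ℚ.+-identityˡ s)))
  where
  s = (-1ℤ ℤ.^ i) / 1
  c = (-1ℤ ℤ.^ i) / suc i
logCoeff-sign (suc i) (suc j) = begin
  fromℕ (suc i) ℚ.* l               ≡⟨ suc-* i ⟩
  l ℚ.+ fromℕ i ℚ.* l               ≡⟨ cong (l ℚ.+_) (logCoeff-sign i j) ⟩
  l ℚ.+ (fromℕ j ℚ.* l ℚ.+ s)       ≡⟨ ℚ.+-assoc l (fromℕ j ℚ.* l) s ⟨
  (l ℚ.+ fromℕ j ℚ.* l) ℚ.+ s       ≡⟨ cong (ℚ._+ s) (suc-* j) ⟨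
  fromℕ (suc j) ℚ.* l ℚ.+ s         ∎
  where
  l = logCoeff i j
  s = sign i j
  suc-* : ∀ n → fromℕ (suc n) ℚ.* l ≡ l ℚ.+ fromℕ n ℚ.* l
  suc-* n = trans (cong (ℚ._* l) (fromℕ-suc n)) (trans (ℚ.*-distribʳ-+ l 1ℚ (fromℕ n))
    (cong (ℚ._+ fromℕ n ℚ.* l) (ℚ.*-identityˡ l)))

-- This is [log (1 + 1/y), y d/dy (1 + y)] = 1, read off coefficientwise.
logCoeff-commutator : ∀ i j →
  fromℕ i ℚ.* logCoeff i j ℚ.+ fromℕ (suc i) ℚ.* logCoeff (suc i) j
    ≡ δ i j ℚ.+ fromℕ j ℚ.* (logCoeff i j ℚ.+ logCoeff (suc i) j)
logCoeff-commutator i j = begin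
  fromℕ i ℚ.* l ℚ.+ fromℕ (suc i) ℚ.* l′
    ≡⟨ cong₂ ℚ._+_ (logCoeff-sign i j) (logCoeff-sign (suc i) j) ⟩
  (fromℕ j ℚ.* l ℚ.+ sign i j) ℚ.+ (fromℕ j ℚ.* l′ ℚ.+ sign (suc i) j)
    ≡⟨ solve 5 (λ a l l′ s s′ → (a :* l :+ s) :+ (a :* l′ :+ s′)
         := (s :+ s′) :+ a :* (l :+ l′)) refl (fromℕ j) l l′ (sign i j) (sign (suc i) j) ⟩
  (sign i j ℚ.+ sign (suc i) j) ℚ.+ fromℕ j ℚ.* (l ℚ.+ l′)
    ≡⟨ cong (ℚ._+ fromℕ j ℚ.* (l ℚ.+ l′)) (sign-suc i j) ⟩
  δ i j ℚ.+ fromℕ j ℚ.* (l ℚ.+ l′) ∎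
  where
  l  = logCoeff i j
  l′ = logCoeff (suc i) j

logCoeff-zero : ∀ {i j} → i ≤ j → logCoeff i j ≡ 0ℚ
logCoeff-zero z≤n       = refl
logCoeff-zero (s≤s i≤j) = logCoeff-zero i≤j

-- Stirling numbers and the polynomials F_n.

stirling₂-zero : ∀ {n k} → n < k → stirling₂ n k ≡ 0
stirling₂-zero {zero}  {suc k} _         = refl
stirling₂-zero {suc n} {suc k} (s≤s n<k) = trans
  (cong₂ (λ a b → suc k * a ℕ.+ b) (stirling₂-zero (ℕ.m<n⇒m<1+n n<k)) (stirling₂-zero n<k))
  (trans (ℕ.+-identityʳ _) (ℕ.*-zeroʳ (suc k)))

-- The number of surjections from an n-set onto a k-set, which is the coefficient of y^k in F_n.
surj : ℕ → ℕ → ℚ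
surj n k = fromℕ (k ! * stirling₂ n k)

surj-zero : ∀ n k → n < k → surj n k ≡ 0ℚ
surj-zero n k n<k =
  cong fromℕ (trans (cong (k ! *_) (stirling₂-zero n<k)) (ℕ.*-zeroʳ (k !)))

-- The coefficient of y^(k+1) in F_{n+1} = y d/dy ((1 + y) F_n); it is the Stirling recurrence
-- multiplied by (k+1)!.
surj-suc : ∀ n k →
  surj (suc n) (suc k) ≡ fromℕ (suc k) ℚ.* (surj n (suc k) ℚ.+ surj n k)
surj-suc n k = trans (cong fromℕ (expand (suc k) (k !) (stirling₂ n (suc k)) (stirling₂ n k)))
  (trans (fromℕ-* (suc k) (suc k ! * stirling₂ n (suc k) ℕ.+ k ! * stirling₂ n k))
    (cong (fromℕ (suc k) ℚ.*_)
      (fromℕ-+ (suc k ! * stirling₂ n (suc k)) (k ! * stirling₂ n k))))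
  where
  expand : ∀ a f s s′ → (a * f) * (a * s ℕ.+ s′) ≡ a * ((a * f) * s ℕ.+ f * s′)
  expand = ℕ-Solver.solve-∀

-- The coefficient of y^j in n F_{n-1}, read as 0 for n = 0.
surj-pred : ℕ → ℕ → ℚ
surj-pred zero    j = 0ℚ
surj-pred (suc n) j = fromℕ (suc n) ℚ.* surj n j

-- The operator y d/dy (1 + y) sends n F_{n-1} to n F_n.
surj-pred-suc : ∀ n j →
  fromℕ (suc j) ℚ.* (surj-pred n (suc j) ℚ.+ surj-pred n j) ≡ fromℕ n ℚ.* surj n (suc j)
surj-pred-suc zero    j = trans (ℚ.*-zeroʳ (fromℕ (suc j))) (sym (ℚ.*-zeroˡ (surj 0 (suc j))))
surj-pred-suc (suc n) j = trans
  (solve 4 (λ a b s s′ → a :* (b :* s :+ b :* s′) := b :* (a :* (s :+ s′))) refl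
    (fromℕ (suc j)) (fromℕ (suc n)) (surj n (suc j)) (surj n j))
  (cong (fromℕ (suc n) ℚ.*_) (sym (surj-suc n j)))

-- With A = y d/dy (1 + y) and L the truncated multiplication by the logarithm, L F_{n+1} = L A F_n
-- = F_n + A L F_n = F_n + n F_n. The bound `n < m` lets the sum reach every coefficient of F_n.
sum-surj-logCoeff : ∀ n m j → n < m →
  sumTo m (λ i → surj n i ℚ.* logCoeff i j) ≡ surj-pred n j
sum-surj-logCoeff zero m j _ = sumTo-zero m term
  where
  term : ∀ i → surj 0 i ℚ.* logCoeff i j ≡ 0ℚ
  term zero    = refl
  term (suc i) = trans (cong (ℚ._* logCoeff (suc i) j) (surj-zero 0 (suc i) (s≤s z≤n)))
    (ℚ.*-zeroˡ (logCoeff (suc i) j))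
sum-surj-logCoeff (suc n) (suc m) j (s≤s n<m) = begin
  sumTo (suc m) (λ i → surj (suc n) i ℚ.* logCoeff i j)
    -- The summand at i = 0 computes to 0, since F_{n+1} has no constant term.
    ≡⟨ ℚ.+-identityˡ _ ⟩
  sumTo m (λ i → surj (suc n) (suc i) ℚ.* logCoeff (suc i) j)
    ≡⟨ sumTo-cong m (λ i → trans (cong (ℚ._* logCoeff (suc i) j) (surj-suc n i))
         (solve 4 (λ a s s′ l → (a :* (s :+ s′)) :* l := a :* s :* l :+ a :* s′ :* l) refl
           (fromℕ (suc i)) (surj n (suc i)) (surj n i) (logCoeff (suc i) j))) ⟩
  sumTo m (λ i → f (suc i) ℚ.+ g i)
    ≡⟨ sumTo-+ m (f ∘ suc) g ⟩
  sumTo m (f ∘ suc) ℚ.+ sumTo m g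
    ≡⟨ cong (ℚ._+ sumTo m g) shift ⟩
  sumTo m f ℚ.+ sumTo m g
    ≡⟨ sumTo-+ m f g ⟨
  sumTo m (λ i → f i ℚ.+ g i)
    ≡⟨ sumTo-cong m commute ⟩
  sumTo m (λ i → surj n i ℚ.* δ i j ℚ.+ fromℕ j ℚ.* (h i ℚ.+ h′ i))
    ≡⟨ sumTo-+ m (λ i → surj n i ℚ.* δ i j) (λ i → fromℕ j ℚ.* (h i ℚ.+ h′ i)) ⟩
  sumTo m (λ i → surj n i ℚ.* δ i j) ℚ.+ sumTo m (λ i → fromℕ j ℚ.* (h i ℚ.+ h′ i))
    ≡⟨ cong₂ ℚ._+_ (sumTo-δ m (surj n) j (λ m≤j → surj-zero n j (ℕ.<-≤-trans n<m m≤j)))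
         (trans (sumTo-*ˡ m (fromℕ j) (λ i → h i ℚ.+ h′ i))
           (cong (fromℕ j ℚ.*_) (trans (sumTo-+ m h h′)
             (cong (ℚ._+ sumTo m h′) (sum-surj-logCoeff n m j n<m))))) ⟩
  surj n j ℚ.+ fromℕ j ℚ.* (surj-pred n j ℚ.+ sumTo m h′)
    ≡⟨ cong (surj n j ℚ.+_) (recursive j) ⟩
  surj n j ℚ.+ fromℕ n ℚ.* surj n j
    ≡⟨ cong (ℚ._+ fromℕ n ℚ.* surj n j) (ℚ.*-identityˡ (surj n j)) ⟨
  1ℚ ℚ.* surj n j ℚ.+ fromℕ n ℚ.* surj n j
    ≡⟨ ℚ.*-distribʳ-+ (surj n j) 1ℚ (fromℕ n) ⟨
  (1ℚ ℚ.+ fromℕ n) ℚ.* surj n j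
    ≡⟨ cong (ℚ._* surj n j) (fromℕ-suc n) ⟨
  fromℕ (suc n) ℚ.* surj n j ∎
  where
  f g h h′ : ℕ → ℚ
  f  i = fromℕ i ℚ.* surj n i ℚ.* logCoeff i j
  g  i = fromℕ (suc i) ℚ.* surj n i ℚ.* logCoeff (suc i) j
  h  i = surj n i ℚ.* logCoeff i j
  h′ i = surj n i ℚ.* logCoeff (suc i) j

  f-last : f m ≡ 0ℚ
  f-last = trans (cong (λ s → fromℕ m ℚ.* s ℚ.* logCoeff m j) (surj-zero n m n<m))
    (trans (cong (ℚ._* logCoeff m j) (ℚ.*-zeroʳ (fromℕ m))) (ℚ.*-zeroˡ (logCoeff m j)))

  -- Reindexing aligns both halves of A F_n at the same `i`, as the commutator requires. Neither end
  -- contributes: `logCoeff 0 j` is 0, and F_n has degree below `m`.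
  shift : sumTo m (f ∘ suc) ≡ sumTo m f
  shift = begin
    sumTo m (f ∘ suc)           ≡⟨ ℚ.+-identityˡ _ ⟨
    0ℚ ℚ.+ sumTo m (f ∘ suc)    ≡⟨ cong (ℚ._+ sumTo m (f ∘ suc)) (ℚ.*-zeroʳ (fromℕ 0 ℚ.* surj n 0)) ⟨
    sumTo (suc m) f             ≡⟨ sumTo-last m f ⟩
    sumTo m f ℚ.+ f m           ≡⟨ cong (sumTo m f ℚ.+_) f-last ⟩
    sumTo m f ℚ.+ 0ℚ            ≡⟨ ℚ.+-identityʳ _ ⟩
    sumTo m f                   ∎

  commute : ∀ i → f i ℚ.+ g i ≡ surj n i ℚ.* δ i j ℚ.+ fromℕ j ℚ.* (h i ℚ.+ h′ i)
  commute i = begin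
    f i ℚ.+ g i
      ≡⟨ solve 5 (λ a b s l l′ → a :* s :* l :+ b :* s :* l′ := s :* (a :* l :+ b :* l′)) refl
           (fromℕ i) (fromℕ (suc i)) (surj n i) (logCoeff i j) (logCoeff (suc i) j) ⟩
    surj n i ℚ.* (fromℕ i ℚ.* logCoeff i j ℚ.+ fromℕ (suc i) ℚ.* logCoeff (suc i) j)
      ≡⟨ cong (surj n i ℚ.*_) (logCoeff-commutator i j) ⟩
    surj n i ℚ.* (δ i j ℚ.+ fromℕ j ℚ.* (logCoeff i j ℚ.+ logCoeff (suc i) j))
      ≡⟨ solve 5 (λ a d s l l′ → s :* (d :+ a :* (l :+ l′)) := s :* d :+ a :* (s :* l :+ s :* l′)) refl
           (fromℕ j) (δ i j) (surj n i) (logCoeff i j) (logCoeff (suc i) j) ⟩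
    surj n i ℚ.* δ i j ℚ.+ fromℕ j ℚ.* (h i ℚ.+ h′ i) ∎

  surj-constant : ∀ k → 0ℚ ≡ fromℕ k ℚ.* surj k 0
  surj-constant zero    = refl
  surj-constant (suc k) = sym (ℚ.*-zeroʳ (fromℕ (suc k)))

  -- For k > 0 the shifted sum is the coefficient of y^(k-1) in L F_n, so the induction hypothesis
  -- applies. At k = 0 it would involve the discarded power y^(-1), but the factor k coming from y
  -- d/dy removes it; truncation is therefore harmless.
  recursive : ∀ k → fromℕ k ℚ.* (surj-pred n k ℚ.+ sumTo m (λ i → surj n i ℚ.* logCoeff (suc i) k))
    ≡ fromℕ n ℚ.* surj n k
  recursive zero    = trans
    (ℚ.*-zeroˡ (surj-pred n 0 ℚ.+ sumTo m (λ i → surj n i ℚ.* logCoeff (suc i) 0)))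
    (surj-constant n)
  recursive (suc k) = trans
    (cong (λ x → fromℕ (suc k) ℚ.* (surj-pred n (suc k) ℚ.+ x)) (sum-surj-logCoeff n m k n<m))
    (surj-pred-suc n k)

-- The equations for j ≥ 1 do not involve the first unknown and form the same system for the shifted
-- sequences. Once these agree, the equation at j = 0 fixes the first unknown, whose coefficient is
-- 1.
logCoeff-unique : ∀ n (f g : ℕ → ℚ) →
  (∀ j → sumTo n (λ i → f i ℚ.* logCoeff (suc i) j) ≡ sumTo n (λ i → g i ℚ.* logCoeff (suc i) j)) →
  ∀ i → i < n → f i ≡ g i
logCoeff-unique (suc n) f g eq = λ where
    zero    _         → head
    (suc i) (s≤s i<n) → tail i i<n
  where
  drop : ∀ (u : ℕ → ℚ) j → sumTo (suc n) (λ i → u i ℚ.* logCoeff (suc i) (suc j))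
    ≡ sumTo n (λ i → u (suc i) ℚ.* logCoeff (suc i) j)
  drop u j = trans (cong (ℚ._+ rest) (ℚ.*-zeroʳ (u 0))) (ℚ.+-identityˡ rest)
    where rest = sumTo n (λ i → u (suc i) ℚ.* logCoeff (suc i) j)

  tail : ∀ i → i < n → f (suc i) ≡ g (suc i)
  tail = logCoeff-unique n (f ∘ suc) (g ∘ suc)
    (λ j → trans (sym (drop f j)) (trans (eq (suc j)) (drop g j)))

  rest : (ℕ → ℚ) → ℚ
  rest u = sumTo n (λ i → u (suc i) ℚ.* logCoeff (suc (suc i)) 0)

  rest-eq : rest f ≡ rest g
  rest-eq = sum-cong-≗ {n} (λ i → cong (ℚ._* logCoeff (suc (suc (toℕ i))) 0)
    (tail (toℕ i) (toℕ<n i)))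

  head : f 0 ≡ g 0
  head = trans (sym (ℚ.*-identityʳ (f 0))) (trans
    (ℚ-+.∙-cancelʳ (rest g) _ _ (trans (cong (f 0 ℚ.* 1ℚ ℚ.+_) (sym rest-eq)) (eq 0)))
    (ℚ.*-identityʳ (g 0)))

-- Kravchuk coefficients as logarithm coefficients.

-1^2+n : ∀ n → -1ℤ ℤ.^ suc (suc n) ≡ -1ℤ ℤ.^ n
-1^2+n n = trans (sym (ℤ.*-assoc -1ℤ -1ℤ (-1ℤ ℤ.^ n))) (ℤ.*-identityˡ (-1ℤ ℤ.^ n))

-- Lowering `n` and `i` together keeps the denominator n - i and changes the exponent by 2, so
-- everything reduces to i = 0.
kravchuk₂-coeff-logCoeff : ∀ n (i : Fin n) → kravchuk₂-coeff n i ≡ logCoeff n (toℕ i)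
kravchuk₂-coeff-logCoeff (suc n) zero = cong (_/ suc n) (begin
  -1ℤ ℤ.^ (suc n ℕ.+ 1 ℕ.+ 0)     ≡⟨ cong (-1ℤ ℤ.^_) (exponent n) ⟩
  -1ℤ ℤ.^ suc (suc n)             ≡⟨ -1^2+n n ⟩
  -1ℤ ℤ.^ n                       ∎)
  where
  exponent : ∀ n → suc n ℕ.+ 1 ℕ.+ 0 ≡ suc (suc n)
  exponent = ℕ-Solver.solve-∀
kravchuk₂-coeff-logCoeff (suc n) (suc i) = trans
  (cong (λ z → _/_ z (n ℕ.∸ toℕ i) {{d}}) (trans (cong (-1ℤ ℤ.^_) (ℕ.+-suc (suc n ℕ.+ 1) (toℕ i)))
    (-1^2+n (n ℕ.+ 1 ℕ.+ toℕ i))))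
  (kravchuk₂-coeff-logCoeff n i)
  where d = ℕ.>-nonZero (ℕ.m<n⇒0<n∸m (toℕ<n i))

-- Reading coefficients of linear forms by evaluation.

eval : ∀ {m} → (Fin m → ℚ) → Poly m → ℚ
eval v (con c) = c
eval v (var i) = v i
eval v (p ⊕ q) = eval v p ℚ.+ eval v q
eval v (p ⊗ q) = eval v p ℚ.* eval v q

-- Since `≈` is a generated congruence, coefficients cannot be read off terms directly; a model in ℚ
-- turns `≈` into equations between rationals.
eval-cong : ∀ {m} (v : Fin m → ℚ) {p q} → p ≈ q → eval v p ≡ eval v q
eval-cong v ≈-refl             = refl
eval-cong v (≈-sym e)          = sym (eval-cong v e)
eval-cong v (≈-trans e e′)     = trans (eval-cong v e) (eval-cong v e′)
eval-cong v (⊕-cong e e′)      = cong₂ ℚ._+_ (eval-cong v e) (eval-cong v e′)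
eval-cong v (⊗-cong e e′)      = cong₂ ℚ._*_ (eval-cong v e) (eval-cong v e′)
eval-cong v (⊕-assoc p q r)    = ℚ.+-assoc (eval v p) (eval v q) (eval v r)
eval-cong v (⊕-comm p q)       = ℚ.+-comm (eval v p) (eval v q)
eval-cong v (⊕-identityˡ p)    = ℚ.+-identityˡ (eval v p)
eval-cong v (⊗-assoc p q r)    = ℚ.*-assoc (eval v p) (eval v q) (eval v r)
eval-cong v (⊗-comm p q)       = ℚ.*-comm (eval v p) (eval v q)
eval-cong v (⊗-identityˡ p)    = ℚ.*-identityˡ (eval v p)
eval-cong v (⊗-zeroˡ p)        = ℚ.*-zeroˡ (eval v p)
eval-cong v (⊗-distribˡ p q r) = ℚ.*-distribˡ-+ (eval v p) (eval v q) (eval v r)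
eval-cong v (con-⊕ a b)        = refl
eval-cong v (con-⊗ a b)        = refl

eval-∑ : ∀ {m} (v : Fin m → ℚ) {n} (p : Fin n → Poly m) →
  eval v (∑[ i < n ] p i) ≡ sum (eval v ∘ p)
eval-∑ v {zero}  p = refl
eval-∑ v {suc n} p = cong (eval v (p zero) ℚ.+_) (eval-∑ v (p ∘ suc))

derivation-∑ : ∀ {m} (f : Fin m → Poly m) {n} (p : Fin n → Poly m) →
  derivation f (∑[ i < n ] p i) ≡ ∑[ i < n ] derivation f (p i)
derivation-∑ f {zero}  p = refl
derivation-∑ f {suc n} p = cong (derivation f (p zero) ⊕_) (derivation-∑ f (p ∘ suc))

-- Evaluation of a linear form at this point extracts its coefficient at x_j.
point : ∀ {m} → ℕ → Fin m → ℚ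
point j i = δ (toℕ i) j

-- The identification of x_i with y^i enters here: `𝒟𝒦₂` of x_p becomes the nonnegative part of y^p
-- log (1 + 1/y).
eval-kravchuk₂-value : ∀ {N} (p : Fin (suc N)) j →
  eval (point j) (kravchuk₂-value p) ≡ logCoeff (toℕ p) j
eval-kravchuk₂-value zero      j = refl
eval-kravchuk₂-value p@(suc _) j = begin
  eval (point j) (kravchuk₂-value p)
    ≡⟨ eval-∑ (point j) (λ i → kravchuk₂-coeff n i · var (inject {i = p} i)) ⟩
  sum {n} (λ i → kravchuk₂-coeff n i ℚ.* δ (toℕ (inject {i = p} i)) j)
    ≡⟨ sum-cong-≗ {n} (λ i → cong₂ ℚ._*_ (kravchuk₂-coeff-logCoeff n i)
         (cong (λ k → δ k j) (Fin.toℕ-inject {i = p} i))) ⟩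
  sumTo n (λ i → logCoeff n i ℚ.* δ i j)
    ≡⟨ sumTo-δ n (logCoeff n) j logCoeff-zero ⟩
  logCoeff n j ∎
  where n = toℕ p

-- The rows of an intertwining map, determined one after another.

module _ {N : ℕ} {ψ : Poly (suc N) → Poly (suc N)}
  (isIntertwining : IsIntertwining (𝒟 N) (𝒟𝒦₂ N) ψ)
  (B : ℕ → ℕ → ℚ)
  (ψ-suc : ∀ (j : Fin N) → ψ (var (suc j)) ≈
    ∑[ i < suc (toℕ j) ] (B (suc (toℕ j)) (suc (toℕ i)) · var (suc (inject≤ i (toℕ<n j)))))
  where

  open IsIntertwining isIntertwining
  open LeftModuleMorphisms.IsLeftModuleHomomorphism isLinear using (*ₗ-homo)

  eval-ψ-suc : ∀ q j → eval (point j) (ψ (var (suc q)))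
    ≡ sumTo (suc (toℕ q)) (λ i → B (suc (toℕ q)) (suc i) ℚ.* δ (suc i) j)
  eval-ψ-suc q j = begin
    eval (point j) (ψ (var (suc q)))
      ≡⟨ eval-cong (point j) (ψ-suc q) ⟩
    eval (point j) (∑[ i < suc (toℕ q) ] term i)
      ≡⟨ eval-∑ (point j) term ⟩
    sum (eval (point j) ∘ term)
      ≡⟨ sum-cong-≗ {suc (toℕ q)} (λ i → cong (λ k → b (toℕ i) ℚ.* δ (suc k) j)
           (Fin.toℕ-inject≤ i (toℕ<n q))) ⟩
    sumTo (suc (toℕ q)) (λ i → b i ℚ.* δ (suc i) j) ∎
    where
    b : ℕ → ℚ
    b i = B (suc (toℕ q)) (suc i)
    term : Fin (suc (toℕ q)) → Poly (suc N)
    term i = b (toℕ i) · var (suc (inject≤ i (toℕ<n q)))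

  eval-𝒟𝒦₂-ψ-suc : ∀ q j → eval (point j) (𝒟𝒦₂ N (ψ (var (suc q))))
    ≡ sumTo (suc (toℕ q)) (λ i → B (suc (toℕ q)) (suc i) ℚ.* logCoeff (suc i) j)
  eval-𝒟𝒦₂-ψ-suc q j = begin
    eval (point j) (𝒟𝒦₂ N (ψ (var (suc q))))
      ≡⟨ eval-cong (point j) (D-cong kravchuk₂-value (ψ-suc q)) ⟩
    eval (point j) (𝒟𝒦₂ N (∑[ i < suc (toℕ q) ] (b i · x i)))
      ≡⟨ cong (eval (point j)) (derivation-∑ kravchuk₂-value (λ i → b i · x i)) ⟩
    eval (point j) (∑[ i < suc (toℕ q) ] 𝒟𝒦₂ N (b i · x i))
      ≡⟨ eval-∑ (point j) (λ i → 𝒟𝒦₂ N (b i · x i)) ⟩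
    sum (λ i → eval (point j) (𝒟𝒦₂ N (b i · x i)))
      ≡⟨ sum-cong-≗ {suc (toℕ q)} (λ i → trans
           (eval-cong (point j) (D-scale kravchuk₂-value (b i) (x i)))
           (cong (b i ℚ.*_) (trans
             (eval-kravchuk₂-value (suc (inject≤ i (toℕ<n q))) j)
             (cong (λ k → logCoeff (suc k) j) (Fin.toℕ-inject≤ i (toℕ<n q)))))) ⟩
    sumTo (suc (toℕ q)) (λ i → B (suc (toℕ q)) (suc i) ℚ.* logCoeff (suc i) j) ∎
    where
    b : Fin (suc (toℕ q)) → ℚ
    b i = B (suc (toℕ q)) (suc (toℕ i))
    x : Fin (suc (toℕ q)) → Poly (suc N)
    x i = var (suc (inject≤ i (toℕ<n q)))

  -- The induction invariant: ψ(x_p) corresponds to F_p, as tested by the evaluations that the next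
  -- row uses.
  IsSurj : Fin (suc N) → Set
  IsSurj p = ∀ j → eval (point j) (ψ (var p)) ≡ surj (toℕ p) j

  -- Intertwining at x_{q+1} turns the known ψ(x_q) into a triangular system for row q + 1 of `B`.
  -- The coefficients of F_{q+1} solve the same system, so uniqueness identifies the two.
  coefficients : ∀ q → IsSurj (inject₁ q) →
    ∀ i → i < suc (toℕ q) → B (suc (toℕ q)) (suc i) ≡ surj (suc (toℕ q)) (suc i)
  coefficients q ψ-q = logCoeff-unique (suc n) (B (suc n) ∘ suc) (surj (suc n) ∘ suc) λ j → begin
    sumTo (suc n) (λ i → B (suc n) (suc i) ℚ.* logCoeff (suc i) j)
      ≡⟨ eval-𝒟𝒦₂-ψ-suc q j ⟨
    eval (point j) (𝒟𝒦₂ N (ψ (var (suc q))))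
      ≡⟨ eval-cong (point j) (intertwines (var (suc q))) ⟨
    eval (point j) (ψ (fromℕ (suc n) · var (inject₁ q)))
      ≡⟨ eval-cong (point j) (*ₗ-homo (fromℕ (suc n)) (var (inject₁ q))) ⟩
    fromℕ (suc n) ℚ.* eval (point j) (ψ (var (inject₁ q)))
      ≡⟨ cong (fromℕ (suc n) ℚ.*_) (trans (ψ-q j) (cong (λ k → surj k j) (Fin.toℕ-inject₁ q))) ⟩
    surj-pred (suc n) j
      -- F_{n+1} has degree n + 1, so n + 2 terms are taken; the one at i = 0 is then dropped
      -- because it is 0.
      ≡⟨ sum-surj-logCoeff (suc n) (suc (suc n)) j ℕ.≤-refl ⟨
    sumTo (suc (suc n)) (λ i → surj (suc n) i ℚ.* logCoeff i j)
      ≡⟨ ℚ.+-identityˡ _ ⟩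
    sumTo (suc n) (λ i → surj (suc n) (suc i) ℚ.* logCoeff (suc i) j) ∎
    where n = toℕ q

  isSurj-suc : ∀ q → IsSurj (inject₁ q) → IsSurj (suc q)
  isSurj-suc q ψ-q j = begin
    eval (point j) (ψ (var (suc q)))
      ≡⟨ eval-ψ-suc q j ⟩
    sumTo (suc n) (λ i → B (suc n) (suc i) ℚ.* δ (suc i) j)
      ≡⟨ sum-cong-≗ {suc n} (λ i → cong (ℚ._* δ (suc (toℕ i)) j)
           (coefficients q ψ-q (toℕ i) (toℕ<n i))) ⟩
    sumTo (suc n) (λ i → surj (suc n) (suc i) ℚ.* δ (suc i) j)
      -- A zero term for i = 0 is restored so that the delta sum starts at 0 and also covers j = 0.
      ≡⟨ ℚ.+-identityˡ _ ⟨
    0ℚ ℚ.+ sumTo (suc n) (λ i → surj (suc n) (suc i) ℚ.* δ (suc i) j)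
      ≡⟨ cong (ℚ._+ sumTo (suc n) (λ i → surj (suc n) (suc i) ℚ.* δ (suc i) j)) (ℚ.*-zeroˡ (δ 0 j)) ⟨
    sumTo (suc (suc n)) (λ i → surj (suc n) i ℚ.* δ i j)
      ≡⟨ sumTo-δ (suc (suc n)) (surj (suc n)) j (surj-zero (suc n) j) ⟩
    surj (suc n) j ∎
    where n = toℕ q

  isSurj : ψ (var zero) ≈ var zero → ∀ p → IsSurj p
  isSurj ψ-zero = Fin.<-weakInduction IsSurj base isSurj-suc
    where
    base : IsSurj zero
    -- F_0 = 1 matches ψ(x_0) = x_0, as x_0 stands for y^0.
    base zero    = eval-cong (point 0) ψ-zero
    base (suc j) = trans (eval-cong (point (suc j)) ψ-zero) (sym (surj-zero 0 (suc j) (s≤s z≤n)))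

lemma3p2 : (N : ℕ) → 1 ≤ N →
    (ψ : Poly (suc N) → Poly (suc N)) →
    IsIntertwining (𝒟 N) (𝒟𝒦₂ N) ψ →
    (B : ℕ → ℕ → ℚ) →
    ψ (var zero) ≈ var zero →
    (∀ (j : Fin N) → ψ (var (suc j)) ≈ ∑[ i < suc (toℕ j) ] (B (suc (toℕ j)) (suc (toℕ i)) · var (suc (inject≤ i (toℕ<n j))))) →
    ∀ (n k : ℕ) → 1 ≤ k → k ≤ n → n ≤ N → B n k ≡ fromℕ (k ! * stirling₂ n k)
lemma3p2 N _ ψ isIntertwining B ψ-zero ψ-suc (suc n) (suc k) _ (s≤s k≤n) n<N =
  -- Row n + 1 belongs to the variable `suc q`. The bound on `k` is part of the motive, since it
  -- must be transported along `toℕ q ≡ n` too.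
  subst (λ n → k ≤ n → B (suc n) (suc k) ≡ surj (suc n) (suc k)) (Fin.toℕ-fromℕ< n<N)
    (λ k≤q → coefficients isIntertwining B ψ-suc q
      (isSurj isIntertwining B ψ-suc ψ-zero (inject₁ q)) k (s≤s k≤q))
    k≤n
  where q = fromℕ< n<N
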